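{- Let $p\ge2$ be a prime. Then (1) $\mathrm{Mod}_p\mathrm{L}$ is closed under intersection, (2) $\mathrm{Mod}_p\mathrm{L}$ is closed under complement, and (3) $\mathrm{Mod}_p\mathrm{L}$ is closed under union.
   Context: Fix an input alphabet $\Sigma$. An NL-Turing machine is an $O(\log n)$-space bounded nondeterministic Turing machine (read-only input tape, space counted on the work tape, halting on all paths). $\sharp\mathrm{L}$ is the class of functions $f:\Sigma^*\to\{0,1,2,\dots\}$ for which there is an NL-Turing machine $M$ with $f(x)$ equal to the number of accepting computation paths of $M$ on $x$. For an integer $k\ge2$, $\mathrm{Mod}_k\mathrm{L}$ is the class of languages $L\subseteq\Sigma^*$ for which there is $f\in\sharp\mathrm{L}$ such that for all $x\in\Sigma^*$: $x\in L$ if and only if $f(x)\not\equiv0\pmod k$. -}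

module Defs where

open import Level using (0ℓ)
open import Data.Bool.Base using (Bool; false; T)
open import Data.Fin.Base using (Fin)
open import Data.List.Base using (List; []; _∷_; length)
open import Data.Nat.Base using (ℕ; zero; suc; pred; _+_; _*_; _≤_; ∣_-_∣)
open import Data.Nat.Divisibility.Core using (_∣_)
open import Data.Nat.Logarithm using (⌊log₂_⌋)
open import Data.Product.Base using (_×_; ∃)
open import Function.Base using (flip)
open import Function.Bundles using (_↔_; _⇔_)
open import Induction.WellFounded using (Acc)
open import Relation.Binary.Construct.Closure.ReflexiveTransitive using (Star)
open import Relation.Binary.PropositionalEquality.Core using (_≡_)
open import Relation.Nullary.Negation.Core using (¬_)
open import Relation.Unary using (Pred)

Finite : Set → Set
Finite A = ∃ λ n → A ↔ Fin n

-- Input tapes carry ⊢ x ⊣.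
data InputSymbol (Σ : Set) : Set where
  ⊢ ⊣ : InputSymbol Σ
  sym : Σ → InputSymbol Σ

data Move : Set where
  left stay right : Move

-- There are no transitions out of accept and reject.
data State (Q : Set) : Set where
  active        : Q → State Q
  accept reject : State Q

record Action (Q Γ : Set) : Set where
  constructor action
  field
    next      : State Q
    write     : Γ
    inputMove : Move
    workMove  : Move

-- A nondeterministic machine with one read-only input tape and one two-way
-- infinite work tape.  δ q s γ is the set of actions available in state q when
-- s and γ are scanned.  The input head never crosses an endmarker.
record TuringMachine (Σ : Set) : Set₁ where
  field
    Q       : Set
    Γ       : Set
    Q-fin   : Finite Q
    Γ-fin   : Finite Γ
    start   : State Q
    blank   : Γ
    δ       : Q → InputSymbol Σ → Γ → Action Q Γ → Bool
    ⊢-bound : ∀ q γ r γ′ m → δ q ⊢ γ (action r γ′ left m) ≡ false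
    ⊣-bound : ∀ q γ r γ′ m → δ q ⊣ γ (action r γ′ right m) ≡ false

-- The cells visited so far: those to the left of the head (nearest first), the
-- scanned cell, and those to the right (nearest first).  All other cells are
-- blank.
record Tape (Γ : Set) : Set where
  constructor tape
  field
    before  : List Γ
    scanned : Γ
    after   : List Γ

cellsVisited : ∀ {Γ} → Tape Γ → ℕ
cellsVisited (tape ls _ rs) = length ls + suc (length rs)

writeTape : ∀ {Γ} → Γ → Tape Γ → Tape Γ
writeTape γ (tape ls _ rs) = tape ls γ rs

moveTape : ∀ {Γ} → Γ → Move → Tape Γ → Tape Γ
moveTape blank left  (tape []       γ rs)       = tape [] blank (γ ∷ rs)
moveTape blank left  (tape (l ∷ ls) γ rs)       = tape ls l (γ ∷ rs)
moveTape blank stay  t                          = t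
moveTape blank right (tape ls       γ [])       = tape (γ ∷ ls) blank []
moveTape blank right (tape ls       γ (r ∷ rs)) = tape (γ ∷ ls) r rs

-- Position 0 holds ⊢, positions 1 … |x| hold x, position |x| + 1 holds ⊣.
-- Larger positions are unreachable because of ⊣-bound; their value is
-- irrelevant.
readInput : ∀ {Σ} → List Σ → ℕ → InputSymbol Σ
readInput x zero    = ⊢
readInput x (suc i) = letter x i
  where
  letter : ∀ {Σ} → List Σ → ℕ → InputSymbol Σ
  letter []      _       = ⊣
  letter (a ∷ _) zero    = sym a
  letter (_ ∷ x) (suc i) = letter x i

-- Moving left from position 0 is excluded by ⊢-bound.
movePosition : Move → ℕ → ℕ
movePosition left  i = pred i
movePosition stay  i = i
movePosition right i = suc i

module Computation {Σ : Set} (M : TuringMachine Σ) where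
  open TuringMachine M

  record Configuration : Set where
    constructor conf
    field
      state    : State Q
      position : ℕ
      work     : Tape Γ

  open Configuration public

  initial : Configuration
  initial = conf start 0 (tape [] blank [])

  perform : Action Q Γ → ℕ → Tape Γ → Configuration
  perform (action r γ m m′) i t =
    conf r (movePosition m i) (moveTape blank m′ (writeTape γ t))

  -- Distinct actions lead to distinct configurations, so that sequences of
  -- steps correspond exactly to sequences of configurations.
  data _⊩_⟶_ (x : List Σ) : Configuration → Configuration → Set where
    step : ∀ {q i t} (a : Action Q Γ) →
           T (δ q (readInput x i) (Tape.scanned t) a) →
           x ⊩ conf (active q) i t ⟶ perform a i t

  Path : List Σ → Configuration → Configuration → Set
  Path x = Star (x ⊩_⟶_)

  AcceptingPath : List Σ → Set
  AcceptingPath x = ∃ λ c → Path x initial c × state c ≡ accept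

  -- Well-foundedness of the step relation below the initial configuration is
  -- the constructive form of the absence of infinite computation paths.
  HaltsOnAllPaths : Set
  HaltsOnAllPaths = ∀ x → Acc (flip (x ⊩_⟶_)) initial

  LogSpaceBounded : Set
  LogSpaceBounded =
    ∃ λ k → ∃ λ n₀ → ∀ x → n₀ ≤ length x →
    ∀ c → Path x initial c → cellsVisited (work c) ≤ k * ⌊log₂ length x ⌋

record NLMachine (Σ : Set) : Set₁ where
  field
    machine  : TuringMachine Σ
  open Computation machine public
  field
    halting  : HaltsOnAllPaths
    logSpace : LogSpaceBounded

♯L : ∀ {Σ} → Pred (List Σ → ℕ) _
♯L {Σ} f =
  ∃ λ (M : NLMachine Σ) → ∀ x → NLMachine.AcceptingPath M x ↔ Fin (f x)

_≡_[mod_] : ℕ → ℕ → ℕ → Set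
a ≡ b [mod k ] = k ∣ ∣ a - b ∣

Language : Set → Set₁
Language Σ = Pred (List Σ) 0ℓ

ModL : ∀ {Σ} → ℕ → Pred (Language Σ) _
ModL k L = ∃ λ f → ♯L f × (∀ x → L x ⇔ (¬ (f x ≡ 0 [mod k ])))

{-# OPTIONS --safe #-}
module Submission where

-- One machine construction suffices: for f and g in ♯L, f · (g + 1) is in ♯L.
-- The machine simulates M₁; whenever M₁ accepts, it rewinds the input head and
-- then either accepts at once or simulates M₂.  Nothing is erased in between:
-- the work alphabet is Γ₁ ⊎ Γ₂, and M₂ reads every symbol of Γ₁ as a blank.
-- Together with the constant 1 this makes n + f, ∏ (f + i) and f · (g + p)
-- members of ♯L.  For a prime p, p ∣ f · (g + p) iff p ∣ f or p ∣ g, which gives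
-- intersections, and p ∣ (f + 1) ⋯ (f + p − 1) iff p ∤ f, which gives
-- complements; this replaces the polynomial f ^ (p − 1) + (p − 1) and with it
-- Fermat's little theorem.  Membership is decidable, so unions follow by
-- De Morgan.

open import Defs
open import Data.Bool.Base using (Bool; false; T)
open import Data.Bool.Properties using (T-irrelevant)
open import Data.Empty using (⊥-elim)
open import Data.Fin.Base using (Fin; zero; suc)
import Data.Fin.Properties as Fin
open import Data.List.Base using (List; []; _∷_; length)
open import Data.List.Relation.Unary.All as All using (All; []; _∷_)
open import Data.Maybe.Base using (Maybe; just; nothing; maybe′; zipWith)
open import Data.Maybe.Properties using (just-injective)
open import Data.Nat.Base
open import Data.Nat.Divisibility
open import Data.Nat.DivMod using (_%_; m%n<n; m≡m%n+[m/n]*n; _/_)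
open import Data.Nat.Logarithm using (⌊log₂_⌋; ⌊log₂⌋-mono-≤)
open import Data.Nat.Primality using (Prime; euclidsLemma)
open import Data.Nat.Properties
open import Data.Product.Base using (_×_; _,_; ∃; proj₁; proj₂; Σ-syntax)
open import Data.Product.Properties as Product using (Σ-≡,≡→≡)
open import Data.Product.Function.Dependent.Propositional using (Σ-↔)
open import Data.Product.Function.NonDependent.Propositional using (_×-↔_)
open import Data.Sum
  using (_⊎_; inj₁; inj₂; isInj₁; isInj₂; fromInj₁; fromInj₂; map₂; [_,_]′)
import Data.Sum.Properties as Sum
open import Data.Sum.Function.Propositional using (_⊎-↔_)
open import Data.Unit.Base using (⊤; tt)
open import Function.Base using (_∘_; flip; const)
open import Function.Bundles using (_↔_; _⇔_; mk↔ₛ′; mk⇔; Equivalence)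
open import Function.Properties.Inverse using (↔⇒↣; ↔-sym; ↔-trans; ↔-refl)
import Function.Properties.Equivalence as ⇔
open import Function.Related.TypeIsomorphisms using (Σ-assoc)
open import Induction.WellFounded using (Acc; acc)
open import Relation.Binary.Construct.Closure.ReflexiveTransitive using (ε; _◅_)
open import Relation.Binary.Definitions using (DecidableEquality)
open import Relation.Binary.PropositionalEquality renaming (sym to ≡-sym)
open import Relation.Nullary using (¬_; contradiction)
open import Relation.Nullary.Decidable
  using (Dec; ⌊_⌋; map′; ¬?; _⊎-dec_; isYes≗does; dec-false; toWitness; fromWitness; decidable-stable)
open import Relation.Unary using (_∩_; _∪_; ∁; Decidable)

-- Input tapes, finite types and decidable equality of actions.

mutual
  -- Guarantees that a rewinding head sees `⊢` at position 0 only, so that it cannot stop too early.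
  readInput-suc≢⊢ : ∀ {Σ} (x : List Σ) i → readInput x (suc i) ≢ ⊢
  readInput-suc≢⊢ []      i       ()
  readInput-suc≢⊢ (a ∷ x) zero    ()
  readInput-suc≢⊢ (a ∷ x) (suc i) with a ∷ x | suc i
  ... | y | j = letter≢⊢ y j x i

  -- The local function of readInput, which carries the arguments y and j of
  -- readInput as parameters, has no name here; the call above determines it.
  letter≢⊢ : ∀ {Σ} (y : List Σ) j x i → _ ≢ ⊢ {Σ}
  letter≢⊢ y j []      i       ()
  letter≢⊢ y j (a ∷ x) zero    ()
  letter≢⊢ y j (a ∷ x) (suc i) = letter≢⊢ y j x i

finite⇒≟ : ∀ {A} → Finite A → DecidableEquality A
finite⇒≟ (_ , A↔Fin) = Fin.inj⇒≟ (↔⇒↣ A↔Fin)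

⊎-finite : ∀ {A B} → Finite A → Finite B → Finite (A ⊎ B)
⊎-finite (m , A↔) (n , B↔) = m + n , ↔-trans (A↔ ⊎-↔ B↔) (↔-sym Fin.+↔⊎)

retract⇒≟ : ∀ {A B : Set} (f : A → B) (g : B → A) → (∀ a → g (f a) ≡ a) →
            DecidableEquality B → DecidableEquality A
retract⇒≟ f g g∘f _≟B_ a a′ =
  map′ (λ e → trans (≡-sym (g∘f a)) (trans (cong g e) (g∘f a′))) (cong f) (f a ≟B f a′)

⊤×-↔ : ∀ {B : Set} → B ↔ (⊤ × B)
⊤×-↔ = mk↔ₛ′ (tt ,_) proj₂ (λ _ → refl) (λ _ → refl)

Fin1-↔ : ∀ {A : Fin 1 → Set} → (∃ A) ↔ A zero
Fin1-↔ = mk↔ₛ′ (λ { (zero , a) → a }) (zero ,_) (λ _ → refl) (λ { (zero , _) → refl })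

Fin2-↔ : ∀ {A : Fin 2 → Set} → (∃ A) ↔ (A zero ⊎ A (suc zero))
Fin2-↔ = mk↔ₛ′
  (λ { (zero , a) → inj₁ a ; (suc zero , b) → inj₂ b })
  (λ { (inj₁ a) → zero , a ; (inj₂ b) → suc zero , b })
  (λ { (inj₁ _) → refl ; (inj₂ _) → refl })
  (λ { (zero , _) → refl ; (suc zero , _) → refl })

Move-≟ : DecidableEquality Move
Move-≟ = retract⇒≟ code decode (λ { left → refl ; stay → refl ; right → refl }) Fin._≟_
  where
  code : Move → Fin 3
  code left  = zero
  code stay  = suc zero
  code right = suc (suc zero)
  decode : Fin 3 → Move
  decode zero             = left
  decode (suc zero)       = stay
  decode (suc (suc zero)) = right

State-≟ : ∀ {Q} → DecidableEquality Q → DecidableEquality (State Q)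
State-≟ {Q} _≟_ = retract⇒≟ code decode
  (λ { (active _) → refl ; accept → refl ; reject → refl }) (Sum.≡-dec _≟_ Fin._≟_)
  where
  code : State Q → Q ⊎ Fin 2
  code (active q) = inj₁ q
  code accept     = inj₂ zero
  code reject     = inj₂ (suc zero)
  decode : Q ⊎ Fin 2 → State Q
  decode (inj₁ q)          = active q
  decode (inj₂ zero)       = accept
  decode (inj₂ (suc zero)) = reject

-- `δ` is a Boolean predicate on actions; the rewinding state has to decide whether a given action
-- is among its listed options.
Action-≟ : ∀ {Q Γ} → DecidableEquality Q → DecidableEquality Γ →
           DecidableEquality (Action Q Γ)
Action-≟ _≟Q_ _≟Γ_ = retract⇒≟
  (λ (action r γ m m′) → (r , γ) , (m , m′)) (λ ((r , γ) , (m , m′)) → action r γ m m′)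
  (λ _ → refl)
  (Product.≡-dec (Product.≡-dec (State-≟ _≟Q_) _≟Γ_) (Product.≡-dec Move-≟ Move-≟))

-- Counting accepting paths by their first steps.

module _ {Σ : Set} (M : TuringMachine Σ) where
  open TuringMachine M
  open Computation M

  AcceptingFrom : List Σ → Configuration → Set
  AcceptingFrom x c = ∃ λ d → Path x c d × state d ≡ accept

  -- An enumeration without repetitions of the enabled actions. Paths can then be counted over a
  -- convenient index type instead of the subset cut out by `δ`.
  record Branches {I : Set} (f : I → Action Q Γ) (q : Q) (s : InputSymbol Σ) (γ : Γ) : Set where
    field
      injective : ∀ {i j} → f i ≡ f j → i ≡ j
      enabled   : ∀ i → T (δ q s γ (f i))
      complete  : ∀ a → T (δ q s γ a) → ∃ λ i → f i ≡ a

    index-↔ : I ↔ (∃ λ a → T (δ q s γ a))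
    index-↔ = mk↔ₛ′ (λ i → f i , enabled i) (λ (a , e) → proj₁ (complete a e))
      (λ (a , e) → Σ-≡,≡→≡ (proj₂ (complete a e) , T-irrelevant _ _))
      (λ i → injective (proj₂ (complete (f i) (enabled i))))

  accepting-accept : ∀ {x i t} → AcceptingFrom x (conf accept i t) ↔ ⊤
  accepting-accept = mk↔ₛ′ (λ _ → tt) (λ _ → _ , ε , refl) (λ _ → refl)
    (λ { (_ , ε , refl) → refl ; (_ , () ◅ _ , _) })

  ¬accepting-reject : ∀ {x i t} → ¬ AcceptingFrom x (conf reject i t)
  ¬accepting-reject (_ , ε , ())
  ¬accepting-reject (_ , () ◅ _ , _)

  -- An active state is not accepting, so an accepting path from it is never empty and its first
  -- step can be split off.
  accepting-active : ∀ {x q i t} → AcceptingFrom x (conf (active q) i t) ↔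
    (Σ[ e ∈ (∃ λ a → T (δ q (readInput x i) (Tape.scanned t) a)) ]
      AcceptingFrom x (perform (proj₁ e) i t))
  accepting-active = mk↔ₛ′
    (λ { (_ , ε , ()) ; (d , step a e ◅ p , eq) → (a , e) , d , p , eq })
    (λ { ((a , e) , d , p , eq) → d , step a e ◅ p , eq })
    (λ _ → refl)
    (λ { (_ , ε , ()) ; (_ , step _ _ ◅ _ , _) → refl })

  accepting-branches : ∀ {x q i t I} {f : I → Action Q Γ} →
    Branches f q (readInput x i) (Tape.scanned t) →
    AcceptingFrom x (conf (active q) i t) ↔ (∃ λ j → AcceptingFrom x (perform (f j) i t))
  accepting-branches {x} {q} {i} {t} {I} {f} br =
    ↔-trans (accepting-active {x} {q} {i} {t}) (↔-sym (Σ-↔ (Branches.index-↔ br) ↔-refl))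

  -- A indexes the accepting paths from c.  Long is the proviso of the space
  -- bound, which machines in NLMachine satisfy on long inputs only.
  record Run (x : List Σ) (Long : Set) (N : ℕ) (c : Configuration) (A : Set) : Set where
    field
      halts     : Acc (flip (x ⊩_⟶_)) c
      fits      : Long → ∀ d → Path x c d → cellsVisited (work d) ≤ N
      accepting : AcceptingFrom x c ↔ A

  module _ {x : List Σ} {Long : Set} {N : ℕ} where

    run-cong : ∀ {c A B} → A ↔ B → Run x Long N c A → Run x Long N c B
    run-cong A↔B r = record { Run r ; accepting = ↔-trans (Run.accepting r) A↔B }

    run-accept : ∀ {i t} → (Long → cellsVisited t ≤ N) → Run x Long N (conf accept i t) ⊤
    run-accept small = record
      { halts     = acc λ ()
      ; fits      = λ { l _ ε → small l ; _ _ (() ◅ _) }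
      ; accepting = accepting-accept
      }

    run-reject : ∀ {i t A} → ¬ A → (Long → cellsVisited t ≤ N) → Run x Long N (conf reject i t) A
    run-reject ¬a small = record
      { halts     = acc λ ()
      ; fits      = λ { l _ ε → small l ; _ _ (() ◅ _) }
      ; accepting = mk↔ₛ′ (⊥-elim ∘ ¬accepting-reject) (⊥-elim ∘ ¬a)
                          (⊥-elim ∘ ¬a) (⊥-elim ∘ ¬accepting-reject)
      }

    -- By `complete` every first step is some `f j`, so halting and space pass from the successors
    -- to the configuration; the accepting paths add up over `j`.
    run-branches : ∀ {q i t I} {f : I → Action Q Γ} {A : I → Set} →
      Branches f q (readInput x i) (Tape.scanned t) → (Long → cellsVisited t ≤ N) →
      (∀ j → Run x Long N (perform (f j) i t) (A j)) →
      Run x Long N (conf (active q) i t) (∃ A)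
    run-branches {q} {i} {t} {f = f} br small runs = record
      { halts     = acc λ { (step a e) → halts′ a e }
      ; fits      = λ { l _ ε → small l ; l d (step a e ◅ p) → fits′ l a e d p }
      ; accepting = ↔-trans (accepting-branches {x} {q} {i} {t} br)
                            (Σ-↔ ↔-refl (λ {j} → Run.accepting (runs j)))
      }
      where
      halts′ : ∀ a → T (δ q (readInput x i) (Tape.scanned t) a) →
               Acc (flip (x ⊩_⟶_)) (perform a i t)
      halts′ a e with Branches.complete br a e
      ... | j , refl = Run.halts (runs j)
      fits′ : Long → ∀ a → T (δ q (readInput x i) (Tape.scanned t) a) →
              ∀ d → Path x (perform a i t) d → cellsVisited (work d) ≤ N
      fits′ l a e d p with Branches.complete br a e
      ... | j , refl = Run.fits (runs j) l d p

-- Tapes that agree up to padding.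

module _ {G Γ : Set} (_≈_ : G → Γ → Set) (blank : Γ) where

  -- Cells visited only by the simulating machine look blank to the simulated one.
  data Padded : List G → List Γ → Set where
    padding : ∀ {gs} → All (_≈ blank) gs → Padded gs []
    _∷_     : ∀ {g γ gs γs} → g ≈ γ → Padded gs γs → Padded (g ∷ gs) (γ ∷ γs)

  record PaddedTape (t : Tape G) (u : Tape Γ) : Set where
    constructor padded
    field
      before  : Padded (Tape.before t) (Tape.before u)
      scanned : Tape.scanned t ≈ Tape.scanned u
      after   : Padded (Tape.after t) (Tape.after u)

  module _ {blankᴳ : G} (blank≈ : blankᴳ ≈ blank) where

    -- Where the simulated head leaves its visited cells it finds a blank. The simulating head there
    -- either creates a blank as well or enters a padding cell, which looks blank.
    padded-move : ∀ m {t u} → PaddedTape t u →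
                  PaddedTape (moveTape blankᴳ m t) (moveTape blank m u)
    padded-move left  (padded (padding [])       e r) = padded (padding []) blank≈ (e ∷ r)
    padded-move left  (padded (padding (b ∷ bs)) e r) = padded (padding bs) b (e ∷ r)
    padded-move left  (padded (b ∷ bs)           e r) = padded bs b (e ∷ r)
    padded-move stay  p                               = p
    padded-move right (padded l e (padding []))       = padded (e ∷ l) blank≈ (padding [])
    padded-move right (padded l e (padding (b ∷ bs))) = padded (e ∷ l) b (padding bs)
    padded-move right (padded l e (b ∷ bs))           = padded (e ∷ l) b bs

    module _ (K : ℕ) where

      -- The simulating tape grows only when the simulated one does; entering padding lengthens the
      -- simulated tape alone. The slack `K` allows for cells visited beforehand.
      cellsVisited-move : ∀ m {t u} → PaddedTape t u →
        cellsVisited t ≤ K + cellsVisited u →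
        cellsVisited (moveTape blankᴳ m t) ≤ K + cellsVisited (moveTape blank m u)
      cellsVisited-move left {tape [] _ rs} {tape [] _ rs′} (padded (padding []) _ _) h =
        ≤-trans (s≤s h) (≤-reflexive (≡-sym (+-suc K (suc (length rs′)))))
      cellsVisited-move left {tape (_ ∷ ls) _ rs} (padded (padding (_ ∷ _)) _ _) h
        rewrite +-suc (length ls) (suc (length rs)) = ≤-trans h (+-monoʳ-≤ K (n≤1+n _))
      cellsVisited-move left {tape (_ ∷ ls) _ rs} {tape (_ ∷ ls′) _ rs′} (padded (_ ∷ _) _ _) h
        rewrite +-suc (length ls) (suc (length rs)) | +-suc (length ls′) (suc (length rs′)) = h
      cellsVisited-move stay  _ h = h
      cellsVisited-move right {tape ls _ []} {tape ls′ _ []} (padded _ _ (padding [])) h =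
        ≤-trans (s≤s h) (≤-reflexive (≡-sym (+-suc K (length ls′ + 1))))
      cellsVisited-move right {tape ls _ (_ ∷ rs)} (padded _ _ (padding (_ ∷ _))) h
        rewrite +-suc (length ls) (suc (length rs)) = ≤-trans h (+-monoʳ-≤ K (n≤1+n _))
      cellsVisited-move right {tape ls _ (_ ∷ rs)} {tape ls′ _ (_ ∷ rs′)} (padded _ _ (_ ∷ _)) h
        rewrite +-suc (length ls) (suc (length rs)) | +-suc (length ls′) (suc (length rs′)) = h

-- Embeddings of states, symbols and actions.

record Embedding (A B : Set) : Set where
  field
    encode        : A → B
    -- A partial inverse makes the image decidable, so that a Boolean `δ` can recognise the encoded
    -- actions.
    decode        : B → Maybe A
    decode-encode : ∀ a → decode (encode a) ≡ just a
    encode-decode : ∀ {a} b → decode b ≡ just a → encode a ≡ b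

  encode-injective : ∀ {a a′} → encode a ≡ encode a′ → a ≡ a′
  encode-injective e =
    just-injective (trans (≡-sym (decode-encode _)) (trans (cong decode e) (decode-encode _)))

inj₁-embedding : ∀ {A B} → Embedding A (A ⊎ B)
inj₁-embedding = record
  { encode        = inj₁
  ; decode        = isInj₁
  ; decode-encode = λ _ → refl
  ; encode-decode = λ { (inj₁ _) refl → refl ; (inj₂ _) () }
  }

inj₂-embedding : ∀ {A B} → Embedding B (A ⊎ B)
inj₂-embedding = record
  { encode        = inj₂
  ; decode        = isInj₂
  ; decode-encode = λ _ → refl
  ; encode-decode = λ { (inj₁ _) () ; (inj₂ _) refl → refl }
  }

action-embedding : ∀ {Q Q′ Γ Γ′} → Embedding (State Q) (State Q′) → Embedding Γ Γ′ →
                   Embedding (Action Q Γ) (Action Q′ Γ′)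
action-embedding S G = record
  { encode        = λ (action r γ m m′) → action (S.encode r) (G.encode γ) m m′
  ; decode        = λ (action r γ m m′) →
                      zipWith (λ r γ → action r γ m m′) (S.decode r) (G.decode γ)
  ; decode-encode = λ (action r γ m m′) →
                      cong₂ (zipWith (λ r γ → action r γ m m′)) (S.decode-encode r) (G.decode-encode γ)
  ; encode-decode = encode-decode′
  }
  where
  module S = Embedding S
  module G = Embedding G
  encode-decode′ : ∀ {a} b →
    zipWith (λ r γ → action r γ (Action.inputMove b) (Action.workMove b))
            (S.decode (Action.next b)) (G.decode (Action.write b)) ≡ just a →
    action (S.encode (Action.next a)) (G.encode (Action.write a))
           (Action.inputMove a) (Action.workMove a) ≡ b
  encode-decode′ (action r γ m m′) e with S.decode r in er | G.decode γ in eγ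
  encode-decode′ (action r γ m m′) refl | just _ | just _ =
    cong₂ (λ r γ → action r γ m m′) (S.encode-decode r er) (G.encode-decode γ eγ)

-- Simulation of one machine inside another.

module Simulation {Σ : Set} (M P : TuringMachine Σ) where
  private
    module M where
      open TuringMachine M public
      open Computation M public
    module P where
      open TuringMachine P public
      open Computation P public

  -- The halting states are embedded along with the active ones, and the image of `accept` is left
  -- open: it may be an active state of `P` from which the computation goes on.
  record Simulates : Set₁ where
    field
      states   : Embedding (State M.Q) (State P.Q)
      symbols  : Embedding M.Γ P.Γ
      _≈_      : P.Γ → M.Γ → Set
      embed    : M.Q → P.Q
      encode≈  : ∀ γ → Embedding.encode symbols γ ≈ γ
      blank≈   : P.blank ≈ M.blank
      onActive : ∀ q → Embedding.encode states (active q) ≡ active (embed q)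
      onReject : Embedding.encode states reject ≡ reject

    actions : Embedding (Action M.Q M.Γ) (Action P.Q P.Γ)
    actions = action-embedding states symbols

    field
      δ-decode : ∀ q s {g γ} a → g ≈ γ →
                 P.δ (embed q) s g a ≡ maybe′ (M.δ q s γ) false (Embedding.decode actions a)

  module _ (sim : Simulates) where
    open Simulates sim
    open Embedding actions

    -- An action outside the image of `encode` decodes to `nothing` and is therefore disabled.
    simulated-branches : ∀ {q s g γ} → g ≈ γ →
      Branches P {∃ λ a → T (M.δ q s γ a)} (λ e → encode (proj₁ e)) (embed q) s g
    simulated-branches {q} {s} {g} {γ} g≈γ = record
      { injective = λ e → Σ-≡,≡→≡ (encode-injective e , T-irrelevant _ _)
      ; enabled   = λ (a , e) → subst T (≡-sym (trans (δ-decode q s (encode a) g≈γ)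
                      (cong (maybe′ (M.δ q s γ) false) (decode-encode a)))) e
      ; complete  = λ a e → complete′ a (subst T (δ-decode q s a g≈γ) e)
      }
      where
      complete′ : ∀ a → T (maybe′ (M.δ q s γ) false (decode a)) →
                  ∃ λ (e : ∃ λ a → T (M.δ q s γ a)) → encode (proj₁ e) ≡ a
      complete′ a e with decode a in eq
      ... | just b = (b , e) , encode-decode a eq

    module _ {x : List Σ} {Long : Set} {N K N′ : ℕ} (K+N≤N′ : K + N ≤ N′) {B : Set}
      (onAccept : ∀ {i t u} → PaddedTape _≈_ M.blank t u →
                  (Long → cellsVisited t ≤ K + N) →
                  Run P x Long N′ (P.conf (Embedding.encode states accept) i t) B) where

      -- Induction on the accessibility of the configuration of `M`. An accepting path of `P` is one
      -- of `M` followed by a continuation indexed by `B`, whence the product.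
      run-simulated : ∀ {s i t u} → PaddedTape _≈_ M.blank t u →
        (Long → cellsVisited t ≤ K + cellsVisited u) →
        Acc (flip (x M.⊩_⟶_)) (M.conf s i u) →
        (Long → ∀ d → M.Path x (M.conf s i u) d → cellsVisited (M.work d) ≤ N) →
        Run P x Long N′ (P.conf (Embedding.encode states s) i t) (AcceptingFrom M x (M.conf s i u) × B)
      run-simulated {accept} p small _ fits =
        run-cong P (↔-trans ⊤×-↔ (↔-sym (accepting-accept M) ×-↔ ↔-refl))
          (onAccept p (λ l → ≤-trans (small l) (+-monoʳ-≤ K (fits l _ ε))))
      run-simulated {reject} p small _ fits rewrite onReject =
        run-reject P (¬accepting-reject M ∘ proj₁)
          (λ l → ≤-trans (small l) (≤-trans (+-monoʳ-≤ K (fits l _ ε)) K+N≤N′))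
      run-simulated {active q} {i} {t} {u} p small (acc rs) fits rewrite onActive q =
        run-cong P
          -- The factor `B` is pulled out of the sum over first actions.
          (↔-trans (↔-sym Σ-assoc) (↔-sym (accepting-active M) ×-↔ ↔-refl))
          (run-branches P (simulated-branches (PaddedTape.scanned p))
            (λ l → ≤-trans (small l) (≤-trans (+-monoʳ-≤ K (fits l _ ε)) K+N≤N′))
            λ (a , e) → run-simulated
              (padded-move _≈_ M.blank blank≈ (Action.workMove a) (write≈ a))
              (λ l → cellsVisited-move _≈_ M.blank blank≈ K (Action.workMove a) (write≈ a) (small l))
              (rs (M.step a e)) (λ l d π → fits l d (M.step a e ◅ π)))
        where
        write≈ : ∀ a → PaddedTape _≈_ M.blank
          (writeTape (Embedding.encode symbols (Action.write a)) t) (writeTape (Action.write a) u)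
        write≈ a = padded (PaddedTape.before p) (encode≈ _) (PaddedTape.after p)

-- The machine for f · (g + 1).

module Multiplication {Σ : Set} (M₁ M₂ : TuringMachine Σ) where
  private
    module M₁ where
      open TuringMachine M₁ public
      open Computation M₁ public
    module M₂ where
      open TuringMachine M₂ public
      open Computation M₂ public

  Q Γ : Set
  Q = M₁.Q ⊎ (⊤ ⊎ M₂.Q)
  Γ = M₁.Γ ⊎ M₂.Γ

  pattern first q  = inj₁ q
  pattern rewind   = inj₂ (inj₁ tt)
  pattern second q = inj₂ (inj₂ q)

  Q-finite : Finite Q
  Q-finite = ⊎-finite M₁.Q-fin (⊎-finite (1 , ↔-sym Fin.1↔⊤) M₂.Q-fin)

  Γ-finite : Finite Γ
  Γ-finite = ⊎-finite M₁.Γ-fin M₂.Γ-fin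

  states₁ : Embedding (State M₁.Q) (State Q)
  states₁ = record
    { encode        = λ { (active q) → active (first q) ; accept → active rewind
                        ; reject → reject }
    ; decode        = λ { (active (first q)) → just (active q) ; (active rewind) → just accept
                        ; (active (second _)) → nothing ; accept → nothing
                        ; reject → just reject }
    ; decode-encode = λ { (active _) → refl ; accept → refl ; reject → refl }
    ; encode-decode = λ { (active (first _)) refl → refl ; (active rewind) refl → refl
                        ; (active (second _)) () ; accept () ; reject refl → refl }
    }

  states₂ : Embedding (State M₂.Q) (State Q)
  states₂ = record
    { encode        = λ { (active q) → active (second q) ; accept → accept ; reject → reject }
    ; decode        = λ { (active (first _)) → nothing ; (active rewind) → nothing
                        ; (active (second q)) → just (active q) ; accept → just accept
                        ; reject → just reject }
    ; decode-encode = λ { (active _) → refl ; accept → refl ; reject → refl }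
    ; encode-decode = λ { (active (first _)) () ; (active rewind) ()
                        ; (active (second _)) refl → refl ; accept refl → refl ; reject refl → refl }
    }

  actions₁ : Embedding (Action M₁.Q M₁.Γ) (Action Q Γ)
  actions₁ = action-embedding states₁ inj₁-embedding

  actions₂ : Embedding (Action M₂.Q M₂.Γ) (Action Q Γ)
  actions₂ = action-embedding states₂ inj₂-embedding

  view₁ : Γ → M₁.Γ
  view₁ = fromInj₁ (const M₁.blank)

  view₂ : Γ → M₂.Γ
  view₂ = fromInj₂ (const M₂.blank)

  -- Only the rewound head, on `⊢`, has a choice: accepting at once contributes the 1 in g + 1,
  -- starting `M₂` contributes g.
  arity : InputSymbol Σ → ℕ
  arity ⊢       = 2
  arity ⊣       = 1
  arity (sym _) = 1

  back : Γ → Action Q Γ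
  back g = action (active rewind) g left stay

  -- The input moves differ, so the two actions on ⊢ remain distinct when M₂
  -- starts in accept.
  option : ∀ s → Γ → Fin (arity s) → Action Q Γ
  option ⊢       g zero       = action accept g right stay
  option ⊢       g (suc zero) = action (Embedding.encode states₂ M₂.start) g stay stay
  option ⊣       g _          = back g
  option (sym _) g _          = back g

  option? : ∀ s g a → Dec (∃ λ j → option s g j ≡ a)
  option? s g a =
    Fin.any? (λ j → Action-≟ (finite⇒≟ Q-finite) (finite⇒≟ Γ-finite) (option s g j) a)

  δ : Q → InputSymbol Σ → Γ → Action Q Γ → Bool
  δ (first q)  s g a = maybe′ (M₁.δ q s (view₁ g)) false (Embedding.decode actions₁ a)
  δ rewind     s g a = ⌊ option? s g a ⌋
  δ (second q) s g a = maybe′ (M₂.δ q s (view₂ g)) false (Embedding.decode actions₂ a)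

  ¬option⇒false : ∀ s g a → ¬ (∃ λ j → option s g j ≡ a) → ⌊ option? s g a ⌋ ≡ false
  ¬option⇒false s g a ¬o = trans (isYes≗does (option? s g a)) (dec-false (option? s g a) ¬o)

  machine : TuringMachine Σ
  machine = record
    { Q       = Q
    ; Γ       = Γ
    ; Q-fin   = Q-finite
    ; Γ-fin   = Γ-finite
    ; start   = Embedding.encode states₁ M₁.start
    -- Under `view₂` this symbol is the blank of `M₂`, so one blank serves both simulations.
    ; blank   = inj₁ M₁.blank
    ; δ       = δ
    ; ⊢-bound = λ
      { (first q)  g r g′ m → maybe-decode states₁ inj₁-embedding r g′
                                λ r γ → M₁.⊢-bound q _ r γ m
      ; rewind     g r g′ m → ¬option⇒false ⊢ g _ λ { (zero , ()) ; (suc zero , ()) }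
      ; (second q) g r g′ m → maybe-decode states₂ inj₂-embedding r g′
                                λ r γ → M₂.⊢-bound q _ r γ m
      }
    ; ⊣-bound = λ
      { (first q)  g r g′ m → maybe-decode states₁ inj₁-embedding r g′
                                λ r γ → M₁.⊣-bound q _ r γ m
      ; rewind     g r g′ m → ¬option⇒false ⊣ g _ λ { (zero , ()) }
      ; (second q) g r g′ m → maybe-decode states₂ inj₂-embedding r g′
                                λ r γ → M₂.⊣-bound q _ r γ m
      }
    }
    where
    maybe-decode : ∀ {Q′ Γ′} (S : Embedding (State Q′) (State Q)) (G : Embedding Γ′ Γ) r g {m m′ f} →
      (∀ r γ → f (action r γ m m′) ≡ false) →
      maybe′ f false (Embedding.decode (action-embedding S G) (action r g m m′)) ≡ false
    maybe-decode S G r g h with Embedding.decode S r | Embedding.decode G g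
    ... | just r′ | just γ′ = h r′ γ′
    ... | just _  | nothing = refl
    ... | nothing | _       = refl

  open Computation machine

  option-branches : ∀ s g → Branches machine (option s g) rewind s g
  option-branches s g = record
    { injective = option-injective s
    ; enabled   = λ j → fromWitness (j , refl)
    ; complete  = λ a → toWitness
    }
    where
    option-injective : ∀ s {i j} → option s g i ≡ option s g j → i ≡ j
    option-injective ⊢       {zero}     {zero}     _ = refl
    option-injective ⊢       {zero}     {suc zero} ()
    option-injective ⊢       {suc zero} {zero}     ()
    option-injective ⊢       {suc zero} {suc zero} _ = refl
    option-injective ⊣       {zero}     {zero}     _ = refl
    option-injective (sym _) {zero}     {zero}     _ = refl

  -- Away from `⊢` the arity is 1, but it reduces only after a case split on `s`; here the index
  -- type no longer depends on `s`.
  back-branches : ∀ s g → s ≢ ⊢ → Branches machine {Fin 1} (λ _ → back g) rewind s g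
  back-branches ⊢       g s≢⊢ = contradiction refl s≢⊢
  back-branches ⊣       g _   = option-branches ⊣ g
  back-branches (sym a) g _   = option-branches (sym a) g

  simulates₁ : Simulation.Simulates M₁ machine
  simulates₁ = record
    { states   = states₁
    ; symbols  = inj₁-embedding
    -- Stricter than agreement under `view₁`: it records that only symbols of `M₁.Γ` are on the
    -- tape, as `fresh` requires.
    ; _≈_      = λ g γ → g ≡ inj₁ γ
    ; embed    = inj₁
    ; encode≈  = λ _ → refl
    ; blank≈   = refl
    ; onActive = λ _ → refl
    ; onReject = refl
    ; δ-decode = λ { q s a refl → refl }
    }

  _≈₂_ : Γ → M₂.Γ → Set
  g ≈₂ γ = view₂ g ≡ γ

  simulates₂ : Simulation.Simulates M₂ machine
  simulates₂ = record
    { states   = states₂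
    ; symbols  = inj₂-embedding
    ; _≈_      = _≈₂_
    ; embed    = λ q → inj₂ (inj₂ q)
    ; encode≈  = λ _ → refl
    ; blank≈   = refl
    ; onActive = λ _ → refl
    ; onReject = refl
    ; δ-decode = λ { q s a refl → refl }
    }

  -- Every symbol left behind by `M₁` is a blank to `M₂`, so all cells around the head become
  -- padding of an empty tape.
  fresh : ∀ {t u} → PaddedTape (λ g γ → g ≡ inj₁ γ) M₁.blank t u →
          PaddedTape _≈₂_ M₂.blank t (tape [] M₂.blank [])
  fresh (padded b s a) = padded (padding (blanks b)) (cong view₂ s) (padding (blanks a))
    where
    blanks : ∀ {gs γs} → Padded (λ g γ → g ≡ inj₁ γ) M₁.blank gs γs → All (_≈₂ M₂.blank) gs
    blanks (padding es) = All.map (cong view₂) es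
    blanks (e ∷ es)     = cong view₂ e ∷ blanks es

  module _ (x : List Σ) (Long : Set) (N₁ N₂ : ℕ)
    (halting₁ : Acc (flip (x M₁.⊩_⟶_)) M₁.initial)
    (halting₂ : Acc (flip (x M₂.⊩_⟶_)) M₂.initial)
    (space₁ : Long → ∀ c → M₁.Path x M₁.initial c → cellsVisited (M₁.work c) ≤ N₁)
    (space₂ : Long → ∀ c → M₂.Path x M₂.initial c → cellsVisited (M₂.work c) ≤ N₂) where

    -- Induction on the head position; the work tape stays as it is until position 0 is reached.
    run-rewind : ∀ i {t} → PaddedTape _≈₂_ M₂.blank t (tape [] M₂.blank []) →
      (Long → cellsVisited t ≤ N₁) →
      Run machine x Long (N₁ + N₂) (conf (active rewind) i t) (⊤ ⊎ (M₂.AcceptingPath x × ⊤))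
    run-rewind zero {t} p small =
      run-cong machine (Fin2-↔ {A})
        (run-branches machine {A = A} (option-branches ⊢ (Tape.scanned t)) small′ λ
          { zero       → run-accept machine small′
          ; (suc zero) → Simulation.run-simulated M₂ machine simulates₂ ≤-refl
              (λ _ → run-accept machine)
              -- The slack for the second simulation is `N₁`; the 1 is the single cell of the fresh
              -- tape of `M₂`.
              p (λ l → ≤-trans (small l) (m≤m+n N₁ 1)) halting₂ space₂
          })
      where
      A : Fin 2 → Set
      A zero    = ⊤
      A (suc _) = M₂.AcceptingPath x × ⊤
      small′ : Long → cellsVisited t ≤ N₁ + N₂
      small′ l = ≤-trans (small l) (m≤m+n N₁ N₂)
    run-rewind (suc i) {t} p small =
      run-cong machine Fin1-↔
        (run-branches machine (back-branches _ (Tape.scanned t) (readInput-suc≢⊢ x i))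
          (λ l → ≤-trans (small l) (m≤m+n N₁ N₂)) λ _ → run-rewind i p small)

    run-initial : Run machine x Long (N₁ + N₂) initial
      (M₁.AcceptingPath x × (⊤ ⊎ (M₂.AcceptingPath x × ⊤)))
    -- Both machines start with one visited cell, so the first simulation needs no slack.
    run-initial = Simulation.run-simulated M₁ machine simulates₁ {K = 0} (m≤m+n N₁ N₂)
      (λ p small → run-rewind _ (fresh p) small)
      (padded (padding []) refl (padding [])) (λ _ → ≤-refl) halting₁ space₁

-- Closure properties of ♯L.

module _ {Σ : Set} (M₁ M₂ : NLMachine Σ) where
  private
    module M₁ = NLMachine M₁
    module M₂ = NLMachine M₂
  open Multiplication M₁.machine M₂.machine

  private
    k₁ = proj₁ M₁.logSpace
    k₂ = proj₁ M₂.logSpace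
    n₁ = proj₁ (proj₂ M₁.logSpace)
    n₂ = proj₁ (proj₂ M₂.logSpace)

    run : ∀ x → Run machine x
                  (n₁ ⊔ n₂ ≤ length x) (k₁ * ⌊log₂ length x ⌋ + k₂ * ⌊log₂ length x ⌋)
                  (Computation.initial machine)
                  (M₁.AcceptingPath x × (⊤ ⊎ (M₂.AcceptingPath x × ⊤)))
    run x = run-initial x _ _ _ (M₁.halting x) (M₂.halting x)
      (λ long → proj₂ (proj₂ M₁.logSpace) x (≤-trans (m≤m⊔n n₁ n₂) long))
      (λ long → proj₂ (proj₂ M₂.logSpace) x (≤-trans (m≤n⊔m n₁ n₂) long))

  product-suc : NLMachine Σ
  product-suc = record
    { machine  = machine
    ; halting  = λ x → Run.halts (run x)
    -- The constants add because cells visited by `M₁` stay on the tape while `M₂` runs; beyond the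
    -- maximum of the thresholds both bounds apply.
    ; logSpace = k₁ + k₂ , n₁ ⊔ n₂ , λ x long c π →
        ≤-trans (Run.fits (run x) long c π)
                (≤-reflexive (≡-sym (*-distribʳ-+ ⌊log₂ length x ⌋ k₁ k₂)))
    }

  product-suc-accepting : ∀ x → NLMachine.AcceptingPath product-suc x ↔
                                (M₁.AcceptingPath x × (⊤ ⊎ (M₂.AcceptingPath x × ⊤)))
  product-suc-accepting x = Run.accepting (run x)

♯L-*-suc : ∀ {Σ} {f g : List Σ → ℕ} → ♯L f → ♯L g → ♯L (λ x → f x * suc (g x))
♯L-*-suc (M , M↔f) (M′ , M′↔g) = product-suc M M′ , λ x →
  ↔-trans (product-suc-accepting M M′ x)
    (↔-trans (M↔f x ×-↔ (↔-sym Fin.1↔⊤ ⊎-↔ ↔-trans ×⊤-↔ (M′↔g x)))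
      (↔-trans (↔-refl ×-↔ ↔-sym Fin.+↔⊎) (↔-sym Fin.*↔×)))
  where
  ×⊤-↔ : ∀ {B : Set} → (B × ⊤) ↔ B
  ×⊤-↔ = mk↔ₛ′ proj₁ (_, tt) (λ _ → refl) (λ _ → refl)

♯L-cong : ∀ {Σ} {f g : List Σ → ℕ} → (∀ x → f x ≡ g x) → ♯L f → ♯L g
♯L-cong f≗g (M , M↔f) = M , λ x → subst (λ n → _ ↔ Fin n) (f≗g x) (M↔f x)

♯L-1 : ∀ {Σ} → ♯L {Σ} (λ _ → 1)
♯L-1 {Σ} = record
  { machine  = immediate
  ; halting  = λ _ → acc λ ()
  -- One cell is visited, and the logarithm is at least 1 from length 2 on.
  ; logSpace = 1 , 2 , λ
      { _ 2≤|x| _ ε → ≤-trans (⌊log₂⌋-mono-≤ 2≤|x|) (≤-reflexive (≡-sym (*-identityˡ _)))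
      ; _ _ _ (() ◅ _)
      }
  } , λ x → ↔-trans (accepting-accept immediate) (↔-sym Fin.1↔⊤)
  where
  immediate : TuringMachine Σ
  immediate = record
    { Q       = Fin 0
    ; Γ       = Fin 1
    ; Q-fin   = 0 , ↔-refl
    ; Γ-fin   = 1 , ↔-refl
    ; start   = accept
    ; blank   = zero
    ; δ       = λ ()
    ; ⊢-bound = λ ()
    ; ⊣-bound = λ ()
    }

-- Each increment is a product 1 · (g + 1).
♯L-+ : ∀ {Σ} {f : List Σ → ℕ} n → ♯L f → ♯L (λ x → n + f x)
♯L-+ zero    F = F
♯L-+ (suc n) F = ♯L-cong (λ _ → *-identityˡ _) (♯L-*-suc ♯L-1 (♯L-+ n F))

-- The rising factorial (a + 1) ⋯ (a + n), with each new factor in the successor form that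
-- `♯L-*-suc` provides.
rising : ℕ → ℕ → ℕ
rising a zero    = 1
rising a (suc n) = rising a n * suc (n + a)

♯L-rising : ∀ {Σ} {f : List Σ → ℕ} n → ♯L f → ♯L (λ x → rising (f x) n)
♯L-rising zero    F = ♯L-1
♯L-rising (suc n) F = ♯L-*-suc (♯L-rising n F) (♯L-+ n F)

factor∣rising : ∀ a {i n} → i < n → suc (i + a) ∣ rising a n
factor∣rising a {i} {suc n} i<1+n with m<1+n⇒m<n∨m≡n i<1+n
... | inj₁ i<n  = ∣-trans (factor∣rising a i<n) (m∣m*n _)
... | inj₂ refl = n∣m*n (rising a i)

-- Divisibility by a prime and the closure properties of Mod_p L.

module _ {p : ℕ} (2≤p : 2 ≤ p) (p-prime : Prime p) where
  private instance
    p≢0 : NonZero p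
    p≢0 = >-nonZero (≤-trans (s≤s z≤n) 2≤p)

  -- Euclid's lemma, one factor at a time; `2≤p` excludes the empty product 1.
  prime∣rising⇒∣factor : ∀ a n → p ∣ rising a n → ∃ λ i → i < n × p ∣ suc (i + a)
  prime∣rising⇒∣factor a zero    p∣1 = contradiction (∣⇒≤ p∣1) (<⇒≱ 2≤p)
  prime∣rising⇒∣factor a (suc n) p∣r with euclidsLemma (rising a n) (suc (n + a)) p-prime p∣r
  ... | inj₂ p∣f = n , n<1+n n , p∣f
  ... | inj₁ p∣r′ with prime∣rising⇒∣factor a n p∣r′
  ...   | i , i<n , p∣f = i , m<n⇒m<1+n i<n , p∣f

  -- Otherwise `p` divides some factor `suc i + a`, hence also `suc i`, which lies strictly between
  -- 0 and `p`.
  ∣⇒∤rising : ∀ {a} → p ∣ a → ¬ p ∣ rising a (pred p)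
  ∣⇒∤rising {a} p∣a p∣r with prime∣rising⇒∣factor a (pred p) p∣r
  ... | i , i<p-1 , p∣f =
    >⇒∤ (subst (suc (suc i) ≤_) (suc-pred p) (s≤s i<p-1))
        (∣m+n∣m⇒∣n (subst (p ∣_) (+-comm (suc i) a) p∣f) p∣a)

  ∤⇒∣rising : ∀ {a} → ¬ p ∣ a → p ∣ rising a (pred p)
  ∤⇒∣rising {a} p∤a = ∣-trans p∣f (factor∣rising a i<p-1)
    where
    -- `suc i` complements the remainder of `a` to `p`. The remainder is positive, so `suc i` is at
    -- most p - 1 and the factor `suc i + a` does occur.
    i = pred (p ∸ a % p)
    0<r : 0 < a % p
    0<r = n≢0⇒n>0 (p∤a ∘ m%n≡0⇒n∣m a p)
    1+i : suc i ≡ p ∸ a % p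
    1+i = suc-pred (p ∸ a % p) {{>-nonZero (m<n⇒0<n∸m (m%n<n a p))}}
    i<p-1 : i < pred p
    i<p-1 = ≤-pred (subst₂ _≤_ (cong suc (≡-sym 1+i)) (≡-sym (suc-pred p))
                      (∸-monoʳ-< 0<r (<⇒≤ (m%n<n a p))))
    p∣f : p ∣ suc (i + a)
    p∣f = subst (p ∣_) (≡-sym eq) (∣m∣n⇒∣m+n ∣-refl (n∣m*n (a / p)))
      where
      open ≡-Reasoning
      eq : suc (i + a) ≡ p + a / p * p
      eq = begin
        suc i + a                          ≡⟨ cong₂ _+_ 1+i (m≡m%n+[m/n]*n a p) ⟩
        p ∸ a % p + (a % p + a / p * p)    ≡⟨ +-assoc (p ∸ a % p) (a % p) _ ⟨
        p ∸ a % p + a % p + a / p * p      ≡⟨ cong (_+ a / p * p) (m∸n+n≡m (<⇒≤ (m%n<n a p))) ⟩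
        p + a / p * p                      ∎

  -- Congruence to 0 unfolds to divisibility of `∣ f x - 0 ∣`, which equals `f x` only up to a
  -- lemma.
  ModL-intro : ∀ {Σ} {L : Language Σ} {f} → ♯L f → (∀ x → L x ⇔ (¬ p ∣ f x)) → ModL p L
  ModL-intro {f = f} F L⇔ = f , F , λ x →
    subst (λ n → _ ⇔ (¬ p ∣ n)) (≡-sym (∣-∣-identityʳ (f x))) (L⇔ x)

  ModL-elim : ∀ {Σ} {L : Language Σ} → ModL p L → ∃ λ f → ♯L f × (∀ x → L x ⇔ (¬ p ∣ f x))
  ModL-elim (f , F , L⇔) = f , F , λ x →
    subst (λ n → _ ⇔ (¬ p ∣ n)) (∣-∣-identityʳ (f x)) (L⇔ x)

  ModL-dec : ∀ {Σ} {L : Language Σ} → ModL p L → Decidable L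
  ModL-dec ML x with ModL-elim ML
  ... | f , _ , L⇔ = map′ (Equivalence.from (L⇔ x)) (Equivalence.to (L⇔ x)) (¬? (p ∣? f x))

  ModL-resp-⇔ : ∀ {Σ} {L L′ : Language Σ} → (∀ x → L x ⇔ L′ x) → ModL p L → ModL p L′
  ModL-resp-⇔ L⇔L′ (f , F , L⇔) = f , F , λ x → ⇔.trans (⇔.sym (L⇔L′ x)) (L⇔ x)

  -- The second factor is `p + b` in the shape that `♯L-*-suc` produces. Modulo `p` the shift
  -- disappears, and Euclid's lemma splits the product.
  ∣*[+p]⇔ : ∀ a b → p ∣ a * suc (pred p + b) ⇔ (p ∣ a ⊎ p ∣ b)
  ∣*[+p]⇔ a b = subst (λ n → p ∣ a * (n + b) ⇔ (p ∣ a ⊎ p ∣ b)) (≡-sym (suc-pred p)) (mk⇔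
    (λ p∣ab → map₂ (λ p∣p+b → ∣m+n∣m⇒∣n p∣p+b ∣-refl) (euclidsLemma a (p + b) p-prime p∣ab))
    [ ∣m⇒∣m*n (p + b) , ∣n⇒∣m*n a ∘ ∣m∣n⇒∣m+n ∣-refl ]′)

  ModL-∩ : ∀ {Σ} {L L′ : Language Σ} → ModL p L → ModL p L′ → ModL p (L ∩ L′)
  ModL-∩ ML ML′ with ModL-elim ML | ModL-elim ML′
  ... | f , F , L⇔ | g , G , L′⇔ =
    ModL-intro (♯L-*-suc F (♯L-+ (pred p) G)) λ x →
      let open Equivalence (∣*[+p]⇔ (f x) (g x)) in mk⇔
        (λ (l , l′) p∣ → [ Equivalence.to (L⇔ x) l , Equivalence.to (L′⇔ x) l′ ]′ (to p∣))
        (λ p∤ → Equivalence.from (L⇔ x) (p∤ ∘ from ∘ inj₁) ,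
                Equivalence.from (L′⇔ x) (p∤ ∘ from ∘ inj₂))

  ModL-∁ : ∀ {Σ} {L : Language Σ} → ModL p L → ModL p (∁ L)
  ModL-∁ ML with ModL-elim ML
  ... | f , F , L⇔ = ModL-intro (♯L-rising (pred p) F) λ x → mk⇔
    -- Membership is a negated divisibility; since divisibility is decidable, refuting membership
    -- yields `p ∣ f x` itself.
    (λ ¬l → ∣⇒∤rising (decidable-stable (p ∣? f x) (¬l ∘ Equivalence.from (L⇔ x))))
    (λ p∤r l → p∤r (∤⇒∣rising (Equivalence.to (L⇔ x) l)))

  ModL-∪ : ∀ {Σ} {L L′ : Language Σ} → ModL p L → ModL p L′ → ModL p (L ∪ L′)
  ModL-∪ {L = L} {L′} ML ML′ = ModL-resp-⇔ deMorgan (ModL-∁ (ModL-∩ (ModL-∁ ML) (ModL-∁ ML′)))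
    where
    deMorgan : ∀ x → (∁ (∁ L ∩ ∁ L′)) x ⇔ (L ∪ L′) x
    deMorgan x = mk⇔
      -- This direction of De Morgan's law is not constructive in general; it holds here because
      -- membership in both languages is decidable.
      (λ h → decidable-stable (ModL-dec ML x ⊎-dec ModL-dec ML′ x) λ ¬∪ → h (¬∪ ∘ inj₁ , ¬∪ ∘ inj₂))
      (λ { (inj₁ l) (¬l , _) → ¬l l ; (inj₂ l′) (_ , ¬l′) → ¬l′ l′ })

theorem3p4 : (Σ : Set) → Finite Σ → (p : ℕ) → 2 ≤ p → Prime p →
    ((L L′ : Language Σ) → ModL p L → ModL p L′ → ModL p (L ∩ L′))
    × ((L : Language Σ) → ModL p L → ModL p (∁ L))
    × ((L L′ : Language Σ) → ModL p L → ModL p L′ → ModL p (L ∪ L′))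
theorem3p4 Σ _ p 2≤p p-prime =
  (λ _ _ → ModL-∩ 2≤p p-prime) , (λ _ → ModL-∁ 2≤p p-prime) , (λ _ _ → ModL-∪ 2≤p p-prime)
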